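{- Let $G$ be a closed group with $\operatorname{GL}(\omega,2)\lneqq G\leq\operatorname{Sym}(\mathbb{F}_2^\omega)$ that does not fix $0$. Then $G=\operatorname{AGL}$ or $G=\operatorname{Sym}(\mathbb{F}_2^\omega)$.
   Context: $\mathbb{F}_2^\omega$ denotes the countably infinite dimensional vector space over the two element field, $\operatorname{GL}(\omega,2)$ its automorphism group, and $\operatorname{Sym}(\mathbb{F}_2^\omega)$ the group of all permutations of its elements. $\operatorname{AGL}$ is the subgroup of $\operatorname{Sym}(\mathbb{F}_2^\omega)$ generated by $\operatorname{GL}(\omega,2)$ and all translations $v\mapsto v+a$ ($a\in\mathbb{F}_2^\omega$). A subgroup $H\le \operatorname{Sym}(\Omega)$ is closed if it is closed in the topology of pointwise convergence: whenever $\pi\in\operatorname{Sym}(\Omega)$ is such that for every finite $S\subset\Omega$ there is $\sigma_S\in H$ with $\sigma_S|_S=\pi|_S$, then $\pi\in H$. -}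

module Defs where

open import Algebra.Bundles using (Group)
open import Algebra.Module.Bundles using (Module)
open import Algebra.Module.Morphism.Structures using (module ModuleMorphisms)
open import Algebra.Module.Structures.Biased using (IsModuleFromLeft)
open import Data.Bool.Base using (Bool; false; _∧_; _xor_)
open import Data.Bool.Properties using (xor-∧-commutativeRing; xor-assoc; xor-comm; xor-identityʳ; xor-same; ∧-assoc; ∧-zeroʳ; ∧-distribˡ-xor; ∧-distribʳ-xor)
open import Data.List.Base using (List)
open import Data.List.Relation.Unary.All using (All)
open import Data.Nat.Base using (ℕ; _⊔_; _≤_)
open import Data.Nat.Properties using (≤-trans; m≤m⊔n; m≤n⊔m)
open import Data.Product.Base using (_,_; _×_; ∃-syntax)
open import Function.Bundles using (Inverse)
import Function.Construct.Composition as Composition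
import Function.Construct.Identity as Identity
import Function.Construct.Symmetry as Symmetry
open import Function.Base using (id)
open import Level using (Level; 0ℓ) renaming (_⊔_ to _⊔ˡ_)
open import Relation.Binary.Bundles using (Setoid)
open import Relation.Binary.Definitions using (_Respects_)
open import Relation.Binary.PropositionalEquality using (_≡_; refl; sym; trans; cong; cong₂)
open import Relation.Unary using (Pred; _∈_; _∪_)

private
  variable
    c e ℓ : Level

record IsSubgroup (𝒢 : Group c e) (H : Pred (Group.Carrier 𝒢) ℓ) : Set (c ⊔ˡ e ⊔ˡ ℓ) where
  open Group 𝒢
  field
    resp      : H Respects _≈_
    ε-closed  : ε ∈ H
    ∙-closed  : ∀ {x y} → x ∈ H → y ∈ H → x ∙ y ∈ H
    ⁻¹-closed : ∀ {x} → x ∈ H → x ⁻¹ ∈ H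

-- `resp` is needed because 𝒢 is a group up to the equivalence _≈_.
data Generated (𝒢 : Group c e) (X : Pred (Group.Carrier 𝒢) ℓ) :
               Pred (Group.Carrier 𝒢) (c ⊔ˡ e ⊔ˡ ℓ) where
  gen  : ∀ {x} → x ∈ X → Generated 𝒢 X x
  resp : ∀ {x y} → Group._≈_ 𝒢 x y → Generated 𝒢 X x → Generated 𝒢 X y
  ε    : Generated 𝒢 X (Group.ε 𝒢)
  _∙_  : ∀ {x y} → Generated 𝒢 X x → Generated 𝒢 X y → Generated 𝒢 X (Group._∙_ 𝒢 x y)
  _⁻¹  : ∀ {x} → Generated 𝒢 X x → Generated 𝒢 X (Group._⁻¹ 𝒢 x)

-- Permutations are invertible maps respecting the setoid equality, compared
-- pointwise; π ∙ ρ applies ρ first.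
Sym : Setoid c e → Group (c ⊔ˡ e) (c ⊔ˡ e)
Sym Ω = record
  { Carrier = Inverse Ω Ω
  ; _≈_     = λ π ρ → ∀ x → to π x ≈ to ρ x
  ; _∙_     = λ π ρ → Composition.inverse ρ π
  ; ε       = Identity.inverse Ω
  ; _⁻¹     = Symmetry.inverse
  ; isGroup = record
    { isMonoid = record
      { isSemigroup = record
        { isMagma = record
          { isEquivalence = record
            { refl  = λ x → Ω.refl
            ; sym   = λ p x → Ω.sym (p x)
            ; trans = λ p q x → Ω.trans (p x) (q x)
            }
          ; ∙-cong = λ {π} {π′} {ρ} {ρ′} p q x → Ω.trans (to-cong π (q x)) (p (to ρ′ x))
          }
        ; assoc = λ π ρ σ x → Ω.refl
        }
      ; identity = (λ π x → Ω.refl) , (λ π x → Ω.refl)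
      }
    ; inverse = strictlyInverseʳ , strictlyInverseˡ
    ; ⁻¹-cong = λ {π} {ρ} p x → inverseʳ π
        (Ω.trans (Ω.sym (strictlyInverseˡ ρ x)) (Ω.sym (p (from ρ x))))
    }
  }
  where
  module Ω = Setoid Ω
  open Ω using (_≈_)
  open Inverse

module _ (Ω : Setoid c e) where
  open Setoid Ω using (_≈_) renaming (Carrier to Point)
  open Inverse using (to)

  -- Closed in the topology of pointwise convergence; finite subsets of Ω are
  -- given by lists of their elements.
  Closed : Pred (Inverse Ω Ω) ℓ → Set (c ⊔ˡ e ⊔ˡ ℓ)
  Closed H = ∀ (π : Inverse Ω Ω) →
    (∀ (S : List Point) → ∃[ σ ] (σ ∈ H × All (λ x → to σ x ≈ to π x) S)) →
    π ∈ H

  Fixes : Pred (Inverse Ω Ω) ℓ → Point → Set (c ⊔ˡ e ⊔ˡ ℓ)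
  Fixes H x = ∀ {σ} → σ ∈ H → to σ x ≈ x

-- The direct sum of countably many copies of 𝔽₂ = (Bool, xor, ∧): sequences
-- vanishing from some index on.  The bound is not part of the identity of a
-- vector: equality below compares coordinates only.
record Vector : Set where
  constructor vector
  field
    coord     : ℕ → Bool
    bound     : ℕ
    vanishing : ∀ {i} → bound ≤ i → coord i ≡ false
open Vector public

infix 4 _≈ᵛ_
record _≈ᵛ_ (u v : Vector) : Set where
  constructor pointwise
  field
    at : ∀ i → coord u i ≡ coord v i
open _≈ᵛ_ public

infixl 6 _+ᵛ_
_+ᵛ_ : Vector → Vector → Vector
u +ᵛ v = vector (λ i → coord u i xor coord v i) (bound u ⊔ bound v) λ b≤i →
  cong₂ _xor_ (vanishing u (≤-trans (m≤m⊔n (bound u) (bound v)) b≤i))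
              (vanishing v (≤-trans (m≤n⊔m (bound u) (bound v)) b≤i))

infixr 7 _*ᵛ_
_*ᵛ_ : Bool → Vector → Vector
a *ᵛ v = vector (λ i → a ∧ coord v i) (bound v) λ b≤i →
  trans (cong (a ∧_) (vanishing v b≤i)) (∧-zeroʳ a)

0ᵛ : Vector
0ᵛ = vector (λ _ → false) 0 λ _ → refl

𝔽₂^ω : Module xor-∧-commutativeRing 0ℓ 0ℓ
𝔽₂^ω = record
  { Carrierᴹ = Vector
  ; _≈ᴹ_     = _≈ᵛ_
  ; _+ᴹ_     = _+ᵛ_
  ; _*ₗ_     = _*ᵛ_
  ; 0ᴹ       = 0ᵛ
  ; -ᴹ_      = id
  ; isModule = IsModuleFromLeft.isModule {commutativeRing = xor-∧-commutativeRing} record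
    { isLeftModule = record
      { isLeftSemimodule = record
        { +ᴹ-isCommutativeMonoid = record
          { isMonoid = record
            { isSemigroup = record
              { isMagma = record
                { isEquivalence = record
                  { refl  = pointwise λ i → refl
                  ; sym   = λ p → pointwise λ i → sym (at p i)
                  ; trans = λ p q → pointwise λ i → trans (at p i) (at q i)
                  }
                ; ∙-cong = λ p q → pointwise λ i → cong₂ _xor_ (at p i) (at q i)
                }
              ; assoc = λ u v w → pointwise λ i → xor-assoc (coord u i) (coord v i) (coord w i)
              }
            ; identity = (λ v → pointwise λ i → refl)
                       , (λ v → pointwise λ i → xor-identityʳ (coord v i))
            }
          ; comm = λ u v → pointwise λ i → xor-comm (coord u i) (coord v i)
          }
        ; isPreleftSemimodule = record
          { *ₗ-cong      = λ p q → pointwise λ i → cong₂ _∧_ p (at q i)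
          ; *ₗ-zeroˡ     = λ v → pointwise λ i → refl
          ; *ₗ-distribʳ  = λ v a b → pointwise λ i → ∧-distribʳ-xor (coord v i) a b
          ; *ₗ-identityˡ = λ v → pointwise λ i → refl
          ; *ₗ-assoc     = λ a b v → pointwise λ i → ∧-assoc a b (coord v i)
          ; *ₗ-zeroʳ     = λ a → pointwise λ i → ∧-zeroʳ a
          ; *ₗ-distribˡ  = λ a u v → pointwise λ i → ∧-distribˡ-xor a (coord u i) (coord v i)
          }
        }
      ; -ᴹ‿cong    = id
      ; -ᴹ‿inverse = (λ v → pointwise λ i → xor-same (coord v i))
                   , (λ v → pointwise λ i → xor-same (coord v i))
      }
    }
  }

module 𝔽₂^ω = Module 𝔽₂^ω

Points : Setoid 0ℓ 0ℓ
Points = 𝔽₂^ω.≈ᴹ-setoid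

Sym[𝔽₂^ω] : Group 0ℓ 0ℓ
Sym[𝔽₂^ω] = Sym Points

Permutation : Set
Permutation = Group.Carrier Sym[𝔽₂^ω]

-- Bijectivity is already part of being a permutation.
GL : Pred Permutation 0ℓ
GL π = IsModuleHomomorphism (Inverse.to π)
  where open ModuleMorphisms 𝔽₂^ω.rawModule 𝔽₂^ω.rawModule using (IsModuleHomomorphism)

-- In characteristic 2 the translation by a is its own inverse.
translation : Vector → Permutation
translation a = record
  { to        = _+ᵛ a
  ; from      = _+ᵛ a
  ; to-cong   = +a-cong
  ; from-cong = +a-cong
  ; inverse   = cancel , cancel
  }
  where
  +a-cong : ∀ {u v} → u ≈ᵛ v → u +ᵛ a ≈ᵛ v +ᵛ a
  +a-cong p = pointwise λ i → cong (_xor coord a i) (at p i)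
  cancel : ∀ {u v} → v ≈ᵛ u +ᵛ a → v +ᵛ a ≈ᵛ u
  cancel {u} p = pointwise λ i →
    trans (cong (_xor coord a i) (at p i))
    (trans (xor-assoc (coord u i) (coord a i) (coord a i))
    (trans (cong (coord u i xor_) (xor-same (coord a i)))
           (xor-identityʳ (coord u i))))

Translations : Pred Permutation 0ℓ
Translations π = ∃[ a ] Group._≈_ Sym[𝔽₂^ω] π (translation a)

AGL : Pred Permutation 0ℓ
AGL = Generated Sym[𝔽₂^ω] (GL ∪ Translations)

{-# OPTIONS --safe #-}
module Submission where

-- Call a finite list of points good if G maps it into the standard basis.
-- G is highly transitive, hence all of Sym by closedness, once every list
-- of distinct points is good. Suppose G is n-transitive (n ≥ 1) but some
-- y ∷ basis n is bad. Transvections show that y lies in the span of the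
-- basis, and that every coordinate of y is 1: if one were 0, replacing that
-- basis vector by y would give n points whose infinitely many good extensions
-- all lie in the finite span of the other basis vectors. So every n-set has
-- exactly one bad extension, and that point is fixed by each linear map
-- preserving the set. For n = l + 2 and l ≠ 1, no point can play this role for
-- the set formed by the first l basis vectors, their sum and one more basis
-- vector. For n = 3 the unique bad extension of {x, y, w} is x + y + w, so
-- that G consists of affine maps.

open import Defs
open import Algebra.Bundles using (CommutativeRing; Group)
open import Algebra.Module.Morphism.Structures using (module ModuleMorphisms)
open import Axiom.ExcludedMiddle using (ExcludedMiddle)
open import Data.Bool.Base using (Bool; true; false; not; _∧_; _xor_)
open import Data.Bool.Properties using (∧-distribˡ-xor; ∧-distribʳ-xor; ∧-zeroʳ; ¬-not;
  xor-same; xor-comm; xor-assoc; xor-identityʳ; xor-∧-commutativeRing)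
open import Data.Empty using (⊥)
open import Data.Fin.Base using (Fin; toℕ; fromℕ<; funToFin; finToFun)
open import Data.Fin.Properties using (pigeonhole; finToFun-funToFin; toℕ-fromℕ<; toℕ-injective; 2↔Bool)
  renaming (<⇒≢ to <⇒≢ᶠ)
open import Data.List.Base using (List; []; _∷_; length; map; downFrom; deduplicate)
open import Data.List.Membership.Setoid Points using (_∈_; _∉_)
open import Data.List.Membership.Setoid.Properties using (∈-resp-≈; ∈-deduplicate⁺)
open import Data.List.Properties using (length-map)
open import Data.List.Relation.Binary.Pointwise.Base using (Pointwise; []; _∷_)
open import Data.List.Relation.Unary.All as All using (All; []; _∷_)
open import Data.List.Relation.Unary.All.Properties using (¬Any⇒All¬; All¬⇒¬Any)
open import Data.List.Relation.Unary.AllPairs using ([]; _∷_)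
open import Data.List.Relation.Unary.Any using (here; there)
open import Data.List.Relation.Unary.Unique.DecSetoid.Properties using (deduplicate-!)
open import Data.List.Relation.Unary.Unique.Setoid Points using (Unique)
open import Data.List.Relation.Unary.Unique.Setoid.Properties using (map⁺)
open import Data.Nat.Base using (ℕ; zero; suc; _≤_; _<_; _^_; _+_; z≤n; s≤s; z<s)
open import Data.Nat.Properties using (_≟_; _<?_; <⇒≢; <⇒≤; ≤⇒≯; ≮⇒≥; ≤-trans; ≤-refl; ≤-pred; ≤∧≢⇒<;
  n<1+n; m<n⇒m<1+n; <-irrefl; 1+n≢n; +-cancelˡ-≡)
open import Data.Product.Base using (_,_; _×_; ∃-syntax; proj₁; proj₂)
open import Data.Sum.Base using (_⊎_; inj₁; inj₂; [_,_])
open import Data.Unit.Base using (⊤; tt)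
open import Function.Base using (_∘_; id)
open import Function.Bundles using (Inverse)
open import Level using (0ℓ; lift; lower)
open import Relation.Binary.Bundles using (Setoid; DecSetoid)
open import Relation.Binary.Definitions using (Decidable)
open import Relation.Binary.PropositionalEquality using (_≡_; _≢_; refl; sym; trans; cong; cong₂; subst; ≢-sym)
open import Relation.Nullary.Decidable using (Dec; yes; no; does; decidable-stable;
  dec-true; dec-false; map′)
open import Relation.Nullary.Negation using (¬_; contradiction)
open import Relation.Unary using (Pred; U; _⊂_; _⊆_; _≐_)

open import Algebra.Properties.CommutativeSemigroup
  (CommutativeRing.+-commutativeSemigroup xor-∧-commutativeRing) using (interchange)
open Group Sym[𝔽₂^ω] using () renaming (_∙_ to _⊙_; ε to 𝟙; _⁻¹ to _⁻)
open Inverse using (to; from; to-cong; from-cong; strictlyInverseˡ; strictlyInverseʳ)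
open ModuleMorphisms 𝔽₂^ω.rawModule 𝔽₂^ω.rawModule using (module IsModuleHomomorphism)
open 𝔽₂^ω using (≈ᴹ-refl; ≈ᴹ-sym; ≈ᴹ-trans)

private
  variable
    k m n i j : ℕ
    w x y z : Vector
    xs ys : List Vector

-- Standard basis vectors and finite supports.

xor-cancelʳ : ∀ a b → (a xor b) xor b ≡ a
xor-cancelʳ a b = trans (xor-assoc a b b) (trans (cong (a xor_) (xor-same b)) (xor-identityʳ a))

to-injective : ∀ (π : Permutation) → to π x ≈ᵛ to π y → x ≈ᵛ y
to-injective {x} {y} π p =
  ≈ᴹ-trans (≈ᴹ-sym (strictlyInverseʳ π x)) (≈ᴹ-trans (from-cong π p) (strictlyInverseʳ π y))

δ : ℕ → Vector
δ k = vector (λ i → does (k ≟ i)) (suc k) λ {i} k<i → dec-false (k ≟ i) (<⇒≢ k<i)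

δ-≡ : ∀ k → coord (δ k) k ≡ true
δ-≡ k = dec-true (k ≟ k) refl

δ-≢ : k ≢ i → coord (δ k) i ≡ false
δ-≢ {k} {i} = dec-false (k ≟ i)

ones : ℕ → Vector
ones n = vector (λ i → does (i <? n)) n λ {i} n≤i → dec-false (i <? n) (≤⇒≯ n≤i)

ones-< : i < n → coord (ones n) i ≡ true
ones-< {i} {n} = dec-true (i <? n)

Supported : ℕ → Pred Vector 0ℓ
Supported n x = ∀ {i} → n ≤ i → coord x i ≡ false

ones-supported : ∀ n → Supported n (ones n)
ones-supported n = vanishing (ones n)

δ-supported : k < n → Supported n (δ k)
δ-supported {k} k<n n≤i = vanishing (δ k) (≤-trans k<n n≤i)

true≢false : true ≢ false
true≢false ()

differ-at : ∀ i → coord x i ≡ true → coord y i ≡ false → ¬ x ≈ᵛ y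
differ-at i xi yi p = true≢false (trans (sym xi) (trans (at p i) yi))

δ-injective : δ i ≈ᵛ δ j → i ≡ j
δ-injective {i} {j} p with i ≟ j
... | yes i≡j = i≡j
... | no  i≢j = contradiction p (differ-at {δ i} {δ j} i (δ-≡ i) (δ-≢ (≢-sym i≢j)))

supported-≈ : Supported n x → Supported n y → (∀ {i} → i < n → coord x i ≡ coord y i) → x ≈ᵛ y
supported-≈ {n} sx sy p = pointwise λ i → go i (i <? n)
  where
  go : ∀ i → Dec (i < n) → _
  go i (yes i<n) = p i<n
  go i (no  i≮n) = trans (sx (≮⇒≥ i≮n)) (sym (sy (≮⇒≥ i≮n)))

-- The first `n` coordinates are encoded as one of `2 ^ n` codes, so two of the first `2 ^ n + 1`
-- terms share theirs.
supported-pigeonhole : (f : ℕ → Vector) → (∀ i → Supported n (f i)) →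
                       ∃[ i ] ∃[ j ] i ≢ j × f i ≈ᵛ f j
supported-pigeonhole {n} f s =
  let i , j , i<j , same = pigeonhole (n<1+n (2 ^ n)) (λ i → funToFin (bits (f (toℕ i))))
  in toℕ i , toℕ j , <⇒≢ᶠ i<j ∘ toℕ-injective , supported-≈ (s _) (s _) (agree {f (toℕ i)} {f (toℕ j)} same)
  where
  bits : Vector → Fin n → Fin 2
  bits x i = from 2↔Bool (coord x (toℕ i))
  agree : funToFin (bits x) ≡ funToFin (bits y) → i < n → coord x i ≡ coord y i
  agree {x} {y} same i<n = subst (λ k → coord x k ≡ coord y k) (toℕ-fromℕ< i<n)
    (trans (sym (strictlyInverseˡ 2↔Bool _))
    (trans (cong (to 2↔Bool)
      (trans (sym (finToFun-funToFin (bits x) _))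
      (trans (cong (λ c → finToFun c (fromℕ< i<n)) same) (finToFun-funToFin (bits y) _))))
    (strictlyInverseˡ 2↔Bool _)))

basis : ℕ → List Vector
basis n = map δ (downFrom n)

basis-All : ∀ {p} {P : Pred Vector p} → (∀ {i} → i < n → P (δ i)) → All P (basis n)
basis-All {zero}  p = []
basis-All {suc n} p = p ≤-refl ∷ basis-All (p ∘ m<n⇒m<1+n)

δ∈basis : i < n → x ≈ᵛ δ i → x ∈ basis n
δ∈basis {i} {suc n} i<1+n p with i ≟ n
... | yes refl = here p
... | no  i≢n  = there (δ∈basis (≤∧≢⇒< (≤-pred i<1+n) i≢n) p)

∈basis⁻ : ∀ n → x ∈ basis n → ∃[ i ] i < n × x ≈ᵛ δ i
∈basis⁻ (suc n) (here p)  = n , ≤-refl , p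
∈basis⁻ (suc n) (there q) = let i , i<n , p = ∈basis⁻ n q in i , m<n⇒m<1+n i<n , p

∷-unique : x ∉ xs → Unique xs → Unique (x ∷ xs)
∷-unique x∉xs xs! = ¬Any⇒All¬ _ x∉xs ∷ xs!

basis-unique : ∀ n → Unique (basis n)
basis-unique zero    = []
basis-unique (suc n) = ∷-unique fresh (basis-unique n)
  where
  fresh : δ n ∉ basis n
  fresh p = let i , i<n , q = ∈basis⁻ n p in <-irrefl (sym (δ-injective q)) i<n

basis-length : ∀ n → length (basis n) ≡ n
basis-length zero    = refl
basis-length (suc n) = cong suc (basis-length n)

-- Linear permutations, functionals and transvections.

Additive : Pred Permutation 0ℓ
Additive π = ∀ x y → to π (x +ᵛ y) ≈ᵛ to π x +ᵛ to π y

-- The only scalars are 0 and 1, and additivity makes the image of 0 equal to its own double, which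
-- is 0.
additive⇒GL : ∀ {π} → Additive π → GL π
additive⇒GL {π} π-+ = record { isBimoduleHomomorphism = record
  { +ᴹ-isGroupHomomorphism = record
    { isMonoidHomomorphism = record
      { isMagmaHomomorphism = record { isRelHomomorphism = record { cong = to-cong π } ; homo = π-+ }
      ; ε-homo = π-0 }
    ; ⁻¹-homo = λ x → ≈ᴹ-refl }
  ; *ₗ-homo = π-*
  ; *ᵣ-homo = π-*
  } }
  where
  π-0 : to π 0ᵛ ≈ᵛ 0ᵛ
  π-0 = pointwise λ i → idem (at (≈ᴹ-trans (to-cong π (pointwise λ _ → refl)) (π-+ 0ᵛ 0ᵛ)) i)
    where
    idem : ∀ {b} → b ≡ b xor b → b ≡ false
    idem {b} p = trans p (xor-same b)
  π-* : ∀ a x → to π (a *ᵛ x) ≈ᵛ a *ᵛ to π x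
  π-* false x = ≈ᴹ-trans (to-cong π (pointwise λ _ → refl)) (≈ᴹ-trans π-0 (pointwise λ _ → refl))
  π-* true  x = ≈ᴹ-trans (to-cong π (pointwise λ _ → refl)) (pointwise λ _ → refl)

GL⇒additive : ∀ {π} → GL π → Additive π
GL⇒additive = IsModuleHomomorphism.+ᴹ-homo

record Functional : Set where
  field
    eval      : Vector → Bool
    eval-cong : x ≈ᵛ y → eval x ≡ eval y
    eval-+    : ∀ x y → eval (x +ᵛ y) ≡ eval x xor eval y
    eval-*    : ∀ a x → eval (a *ᵛ x) ≡ a ∧ eval x
open Functional

coordinate : ℕ → Functional
coordinate i = record
  { eval      = λ x → coord x i
  ; eval-cong = λ p → at p i
  ; eval-+    = λ x y → refl
  ; eval-*    = λ a x → refl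
  }

_⊕_ : Functional → Functional → Functional
φ ⊕ ψ = record
  { eval      = λ x → eval φ x xor eval ψ x
  ; eval-cong = λ p → cong₂ _xor_ (eval-cong φ p) (eval-cong ψ p)
  ; eval-+    = λ x y → trans (cong₂ _xor_ (eval-+ φ x y) (eval-+ ψ x y))
                              (interchange (eval φ x) (eval φ y) (eval ψ x) (eval ψ y))
  ; eval-*    = λ a x → trans (cong₂ _xor_ (eval-* φ a x) (eval-* ψ a x))
                              (sym (∧-distribˡ-xor a (eval φ x) (eval ψ x)))
  }

module _ (φ : Functional) (d : Vector) (φd : eval φ d ≡ false) where

  private
    shear : Vector → Vector
    shear x = x +ᵛ eval φ x *ᵛ d

    shear-cong : x ≈ᵛ y → shear x ≈ᵛ shear y
    shear-cong p = pointwise λ i → cong₂ _xor_ (at p i) (cong (_∧ coord d i) (eval-cong φ p))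

    -- As φ vanishes on `d`, shearing leaves the value of φ unchanged; the second shear adds the
    -- same multiple of `d`, and the two cancel.
    shear-involutive : ∀ x → shear (shear x) ≈ᵛ x
    shear-involutive x = pointwise λ i →
      trans (cong (λ a → (coord x i xor (eval φ x ∧ coord d i)) xor (a ∧ coord d i)) eval-shear)
            (xor-cancelʳ (coord x i) (eval φ x ∧ coord d i))
      where
      eval-shear : eval φ (shear x) ≡ eval φ x
      eval-shear = trans (eval-+ φ x _) (trans (cong (eval φ x xor_) (trans (eval-* φ (eval φ x) d)
        (trans (cong (eval φ x ∧_) φd) (∧-zeroʳ (eval φ x))))) (xor-identityʳ _))

  transvection : Permutation
  transvection = record
    { to        = shear
    ; from      = shear
    ; to-cong   = shear-cong
    ; from-cong = shear-cong
    ; inverse   = (λ p → ≈ᴹ-trans (shear-cong p) (shear-involutive _))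
                , (λ p → ≈ᴹ-trans (shear-cong p) (shear-involutive _))
    }

  transvection-GL : GL transvection
  transvection-GL = additive⇒GL {transvection} λ x y → pointwise λ i →
    trans (cong (λ a → (coord x i xor coord y i) xor (a ∧ coord d i)) (eval-+ φ x y))
          (trans (cong ((coord x i xor coord y i) xor_) (∧-distribʳ-xor (coord d i) (eval φ x) (eval φ y)))
                 (interchange (coord x i) (coord y i) (eval φ x ∧ coord d i) (eval φ y ∧ coord d i)))

  transvection-fixes : eval φ x ≡ false → to transvection x ≈ᵛ x
  transvection-fixes {x} φx = pointwise λ i →
    trans (cong (λ a → coord x i xor (a ∧ coord d i)) φx) (xor-identityʳ _)

  transvection-moves : eval φ x ≡ true → to transvection x ≈ᵛ x +ᵛ d
  transvection-moves {x} φx = pointwise λ i → cong (λ a → coord x i xor (a ∧ coord d i)) φx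

+-cancel : ∀ x y → x +ᵛ (x +ᵛ y) ≈ᵛ y
+-cancel x y = pointwise λ i → go (coord x i) (coord y i)
  where
  go : ∀ a b → a xor (a xor b) ≡ b
  go false b     = refl
  go true  false = refl
  go true  true  = refl

-- With φ u = φ v = 1, the transvection x ↦ x + φ(x)(u + v) exchanges u and v.
module Exchange (φ : Functional) (u v : Vector) (φu : eval φ u ≡ true) (φv : eval φ v ≡ true) where

  private
    vanishes : eval φ (u +ᵛ v) ≡ false
    vanishes = trans (eval-+ φ u v) (cong₂ _xor_ φu φv)

  exchange : Permutation
  exchange = transvection φ (u +ᵛ v) vanishes

  exchange-GL : GL exchange
  exchange-GL = transvection-GL φ (u +ᵛ v) vanishes

  exchange-u : to exchange u ≈ᵛ v
  exchange-u = ≈ᴹ-trans (transvection-moves φ (u +ᵛ v) vanishes {u} φu) (+-cancel u v)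

  exchange-v : to exchange v ≈ᵛ u
  exchange-v = ≈ᴹ-trans (transvection-moves φ (u +ᵛ v) vanishes {v} φv)
    (≈ᴹ-trans (pointwise λ i → cong (coord v i xor_) (xor-comm (coord u i) (coord v i))) (+-cancel v u))

  exchange-fixes : eval φ x ≡ false → to exchange x ≈ᵛ x
  exchange-fixes {x} = transvection-fixes φ (u +ᵛ v) vanishes {x}

  exchange-moves : eval φ x ≡ true → to exchange x ≈ᵛ x +ᵛ (u +ᵛ v)
  exchange-moves {x} = transvection-moves φ (u +ᵛ v) vanishes {x}

+-fixed⇒0 : ∀ x y → x +ᵛ y ≈ᵛ x → ∀ i → coord y i ≡ false
+-fixed⇒0 x y p i = go (coord x i) (coord y i) (at p i)
  where
  go : ∀ a b → a xor b ≡ a → b ≡ false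
  go false b     p = p
  go true  false p = refl

-- A step of Gaussian elimination: exchange `z` with `δ n` along a functional that is 1 on both and
-- 0 on the span of `basis n`. Coordinate `n` serves if it is 1 on `z`, otherwise the sum of
-- coordinates `k` and `n`.
pivot : ∀ n z → n ≤ k → coord z k ≡ true →
        ∃[ π ] GL π × to π z ≈ᵛ δ n × to π (δ n) ≈ᵛ z × (∀ {x} → Supported n x → to π x ≈ᵛ x)
pivot {k} n z n≤k zk with coord z n in zn
... | true = exchange , exchange-GL , exchange-u , exchange-v , λ {x} s → exchange-fixes {x} (s ≤-refl)
  where open Exchange (coordinate n) z (δ n) zn (δ-≡ n)
... | false = exchange , exchange-GL , exchange-u , exchange-v ,
              λ {x} s → exchange-fixes {x} (cong₂ _xor_ (s n≤k) (s ≤-refl))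
  where
  n≢k : n ≢ k
  n≢k refl = true≢false (trans (sym zk) zn)
  open Exchange (coordinate k ⊕ coordinate n) z (δ n) (cong₂ _xor_ zk zn) (cong₂ _xor_ (δ-≢ n≢k) (δ-≡ n))

module Swap (i≢j : i ≢ j) where

  open Exchange (coordinate i ⊕ coordinate j) (δ i) (δ j)
    (cong₂ _xor_ (δ-≡ i) (δ-≢ i≢j)) (cong₂ _xor_ (δ-≢ (≢-sym i≢j)) (δ-≡ j))
    public renaming (exchange to swap; exchange-GL to swap-GL; exchange-u to swap-i; exchange-v to swap-j)

  swap-other : k ≢ i → k ≢ j → to swap (δ k) ≈ᵛ δ k
  swap-other {k} k≢i k≢j = exchange-fixes {δ k} (cong₂ _xor_ (δ-≢ k≢i) (δ-≢ k≢j))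

  -- The predicate `P` carries a bound on the indices through the swap.
  swap-δ : {P : Pred ℕ 0ℓ} → P i → P j → P k → ∃[ l ] P l × to swap (δ k) ≈ᵛ δ l
  swap-δ {k} pi pj pk with k ≟ i | k ≟ j
  ... | yes refl | _        = j , pj , swap-i
  ... | no  _    | yes refl = i , pi , swap-j
  ... | no  k≢i  | no  k≢j  = k , pk , swap-other k≢i k≢j

  coord-swap : ∀ x → coord (to swap x) j ≡ coord x i
  coord-swap x =
    trans (cong (λ a → coord x j xor ((coord x i xor coord x j) ∧ a)) (cong₂ _xor_ (δ-≢ i≢j) (δ-≡ j)))
          (go (coord x i) (coord x j))
    where
    go : ∀ a b → b xor ((a xor b) ∧ true) ≡ a
    go false false = refl
    go false true  = refl
    go true  false = refl
    go true  true  = refl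

-- Lists of points and their images.

Basic : Pred Vector 0ℓ
Basic x = ∃[ k ] x ≈ᵛ δ k

basis-basic : ∀ n → All Basic (basis n)
basis-basic n = basis-All λ {i} _ → i , ≈ᴹ-refl

Sends : Permutation → List Vector → List Vector → Set
Sends π = Pointwise (λ x y → to π x ≈ᵛ y)

Maps : Permutation → List Vector → List Vector → Set
Maps π xs ys = All (λ x → to π x ∈ ys) xs

sends⇒maps : ∀ {π} → Sends π xs ys → Maps π xs ys
sends⇒maps []       = []
sends⇒maps {π = π} (p ∷ ps) = here p ∷ All.map there (sends⇒maps {π = π} ps)

sends⇒maps⁻¹ : ∀ {π} → Sends π xs ys → Maps (π ⁻) ys xs
sends⇒maps⁻¹ []       = []
sends⇒maps⁻¹ {π = π} (p ∷ ps) =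
  here (≈ᴹ-trans (from-cong π (≈ᴹ-sym p)) (strictlyInverseʳ π _)) ∷ All.map there (sends⇒maps⁻¹ {π = π} ps)

maps-fixed : ∀ {π} → All (λ x → to π x ≈ᵛ x) xs → Maps π xs xs
maps-fixed []       = []
maps-fixed {π = π} (p ∷ ps) = here p ∷ All.map there (maps-fixed {π = π} ps)

maps-id : Maps 𝟙 xs xs
maps-id = All.tabulateₛ Points id

-- Good and bad lists.

module _ {ℓ} (em : ExcludedMiddle ℓ) (G : Pred Permutation ℓ)
         (G-subgroup : IsSubgroup Sym[𝔽₂^ω] G) (GL⊆G : GL ⊆ G) where

  open IsSubgroup G-subgroup using (ε-closed; ∙-closed; ⁻¹-closed) renaming (resp to G-resp)

  Good : Pred (List Vector) ℓ
  Good xs = ∃[ g ] G g × All (λ x → Basic (to g x)) xs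

  Bad : Pred (List Vector) ℓ
  Bad xs = ¬ Good xs

  -- Transitivity on ordered lists of `n` distinct points, with `basis n` as the common target.
  HomogeneousAt : ℕ → Set ℓ
  HomogeneousAt n = ∀ {xs} → Unique xs → length xs ≡ n → ∃[ g ] G g × Sends g xs (basis n)

  basic⇒good : All Basic xs → Good xs
  basic⇒good bs = 𝟙 , ε-closed , bs

  -- The images need only be members of `ys`, so that with `𝟙` this also reorders lists.
  good-pull : ∀ {g} → G g → Maps g xs ys → Good ys → Good xs
  good-pull {g = g} g∈G maps (f , f∈G , basics) = f ⊙ g , ∙-closed f∈G g∈G ,
    All.map (All.lookupₛ Points (λ p (k , q) → k , ≈ᴹ-trans (to-cong f (≈ᴹ-sym p)) q) basics) maps

  bad-push : ∀ {g} → G g → Maps g xs ys → Bad (x ∷ xs) → Bad (to g x ∷ ys)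
  bad-push {g = g} g∈G maps bad = bad ∘ good-pull {g = g} g∈G (here ≈ᴹ-refl ∷ All.map there maps)

  -- Otherwise `pivot` would send `y` to `δ n` while fixing `basis n`, which makes the list good.
  bad-supported : Bad (y ∷ basis n) → Supported n y
  bad-supported {y} {n} bad n≤i = ¬-not λ yi →
    let π , π∈GL , πy , _ , fixes = pivot n y n≤i yi
    in bad (π , GL⊆G π∈GL , (n , πy) ∷ basis-All λ {i} i<n → i , fixes (δ-supported i<n))

  bad∉basis : Bad (y ∷ basis n) → y ∉ basis n
  bad∉basis {n = n} bad y∈ = let i , _ , p = ∈basis⁻ n y∈ in bad (basic⇒good ((i , p) ∷ basis-basic n))

  -- If the last coordinate of y is 0, then y ∷ basis m is a list of suc m points
  -- with which every z outside the span of basis m is bad.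
  bad-last : HomogeneousAt (suc m) → Bad (y ∷ basis (suc m)) → coord y m ≢ false
  bad-last {m} {y} hom bad ym =
    let g , g∈G , sends = hom (∷-unique (bad∉basis bad ∘ there) (basis-unique m)) (cong suc (basis-length m))
        -- `g` sends `y ∷ basis m` onto `basis (suc m)`, so the preimage of any later basis vector
        -- is a good extension of that list.
        z : ℕ → Vector
        z k = from g (δ (suc m + k))
        z-supported : ∀ k → Supported m (z k)
        z-supported k m≤i = ¬-not λ zi →
          -- Were `z k` outside the span of `basis m`, exchanging it with `δ m` would carry the bad
          -- list `y ∷ basis (suc m)` into this good one.
          let π , π∈GL , _ , πδ , fixes = pivot m (z k) m≤i zi
          in bad (good-pull {g = π} (GL⊆G π∈GL)
               (there (here (fixes y-supported)) ∷ here πδ ∷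
                basis-All λ i<m → there (there (δ∈basis i<m (fixes (δ-supported i<m)))))
               (good-pull {g = g} g∈G (here (strictlyInverseˡ g _) ∷ All.map there (sends⇒maps {π = g} sends))
                 (basic⇒good ((suc m + k , ≈ᴹ-refl) ∷ basis-basic (suc m)))))
        i , j , i≢j , zi≈zj = supported-pigeonhole z z-supported
    in i≢j (+-cancelˡ-≡ (suc m) i j (δ-injective (to-injective (g ⁻) zi≈zj)))
    where
    y-supported : Supported m y
    y-supported {i} m≤i with m ≟ i
    ... | yes refl = ym
    ... | no  m≢i  = bad-supported bad (≤∧≢⇒< m≤i m≢i)

  -- Swapping `δ i` with the last basis vector preserves the basis and brings coordinate `i` into
  -- the last position.
  bad-coord : HomogeneousAt n → Bad (y ∷ basis n) → i < n → coord y i ≡ true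
  bad-coord {suc m} {y} {i} hom bad i<n with i ≟ m
  ... | yes refl = ¬-not (bad-last hom bad)
  ... | no  i≢m  = ¬-not λ yi → bad-last hom
    (bad-push {g = swap} (GL⊆G swap-GL)
      (basis-All λ j<n → let l , l<n , p = swap-δ {P = _< suc m} i<n ≤-refl j<n in δ∈basis l<n p) bad)
    (trans (coord-swap y) yi)
    where open Swap i≢m

  bad⇒ones : HomogeneousAt n → Bad (y ∷ basis n) → y ≈ᵛ ones n
  bad⇒ones {n} hom bad = supported-≈ (bad-supported bad) (ones-supported n) λ i<n →
    trans (bad-coord hom bad i<n) (sym (ones-< i<n))

  -- Bad extensions of an arbitrary list of `n` distinct points.

  module _ (hom : HomogeneousAt n) (xs! : Unique xs) (|xs|≡n : length xs ≡ n) where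

    private
      g = proj₁ (hom xs! |xs|≡n)
      g∈G = proj₁ (proj₂ (hom xs! |xs|≡n))
      sends = proj₂ (proj₂ (hom xs! |xs|≡n))

    bad-∉ : Bad (x ∷ xs) → x ∉ xs
    bad-∉ bad x∈xs = bad (good-pull {g = g} g∈G
      (All.lookupₛ Points (λ p → ∈-resp-≈ Points (to-cong g p)) maps x∈xs ∷ maps)
      (basic⇒good (basis-basic n)))
      where maps = sends⇒maps {π = g} sends

    -- An element of `G` carrying `xs` to the standard basis carries both points to `ones n`.
    bad-unique : Bad (x ∷ xs) → Bad (y ∷ xs) → x ≈ᵛ y
    bad-unique bad bad′ = to-injective g (≈ᴹ-trans (canonical bad) (≈ᴹ-sym (canonical bad′)))
      where
      canonical : Bad (z ∷ xs) → to g z ≈ᵛ ones n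
      canonical = bad⇒ones hom ∘ bad-push {g = g} g∈G (sends⇒maps {π = g} sends)

    bad-exists : Bad (y ∷ basis n) → ∃[ x ] Bad (x ∷ xs)
    bad-exists {y} bad = from g y , bad-push {g = g ⁻} (⁻¹-closed g∈G) (sends⇒maps⁻¹ {π = g} sends) bad

    bad-fixed : ∀ {π} → GL π → Maps π xs xs → Bad (x ∷ xs) → to π x ≈ᵛ x
    bad-fixed {π = π} π∈GL maps bad = bad-unique (bad-push {g = π} (GL⊆G π∈GL) maps bad) bad

    -- Otherwise the transvection would fix `xs` pointwise but move its unique bad extension by `d`,
    -- which is nonzero at coordinate `i`.
    bad-vanishing : ∀ φ d → eval φ d ≡ false → coord d i ≡ true → All (λ x → eval φ x ≡ false) xs →
                    Bad (x ∷ xs) → eval φ x ≡ false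
    bad-vanishing {i} {x} φ d φd di φxs bad = ¬-not λ φx → true≢false (trans (sym di) (+-fixed⇒0 x d
      (≈ᴹ-trans (≈ᴹ-sym (transvection-moves φ d φd {x} φx))
                (bad-fixed {π = transvection φ d φd} (transvection-GL φ d φd)
                  (maps-fixed {π = transvection φ d φd}
                    (All.map (λ {x} → transvection-fixes φ d φd {x}) φxs)) bad)) i))

  -- No bad extension for `n = 2 + l` other than 3.

  module _ (l : ℕ) (l≢1 : l ≢ 1) (hom : HomogeneousAt (2 + l)) where

    private
      -- This is where `l ≢ 1` enters: for `l = 0` there is no index `i`, and from `l = 2` on there
      -- is a second one.
      another : ∀ i → i < l → ∃[ j ] j < l × i ≢ j
      another = go l l≢1
        where
        go : ∀ l → l ≢ 1 → ∀ i → i < l → ∃[ j ] j < l × i ≢ j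
        go 1             1≢1 _       _ = contradiction refl 1≢1
        go (suc (suc _)) _   zero    _ = 1 , s≤s z<s , λ ()
        go (suc (suc _)) _   (suc _) _ = 0 , z<s , λ ()

      -- For l = 1 its two members coincide.
      circuit : List Vector
      circuit = ones l ∷ basis l

      circuit-supported : All (Supported l) circuit
      circuit-supported = ones-supported l ∷ basis-All δ-supported

      circuit-unique : Unique circuit
      circuit-unique = ∷-unique (λ p →
        let i , i<l , q = ∈basis⁻ l p
            j , j<l , i≢j = another i i<l
        in differ-at {ones l} {δ i} j (ones-< j<l) (δ-≢ i≢j) q) (basis-unique l)

      -- For `l = 0` this consists of `δ 0` and the zero vector.
      extended : List Vector
      extended = δ l ∷ circuit

      extended-unique : Unique extended
      extended-unique =
        All.map (λ {x} s → differ-at {δ l} {x} l (δ-≡ l) (s ≤-refl)) circuit-supported ∷ circuit-unique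

      length-circuit : ∀ x → length (x ∷ circuit) ≡ 2 + l
      length-circuit x = cong (2 +_) (basis-length l)

      module _ (bad : Bad (z ∷ extended)) where

        z∉extended : z ∉ extended
        z∉extended = bad-∉ hom extended-unique (length-circuit (δ l)) bad

        z-supported : Supported (suc l) z
        z-supported {k} l<k = bad-vanishing hom extended-unique (length-circuit (δ l))
          (coordinate k) (δ l) (δ-≢ (<⇒≢ l<k)) (δ-≡ l)
          (δ-≢ (<⇒≢ l<k) ∷ All.map (λ s → s (<⇒≤ l<k)) circuit-supported) bad

        -- Badness is symmetric: if z were in the span of basis l, then δ l would be the
        -- unique bad extension of z ∷ circuit, although linear maps fixing these move δ l.
        z-l : coord z l ≡ true
        z-l = ¬-not λ zl → true≢false (trans (sym (δ-≡ l)) (bad-vanishing hom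
          (∷-unique (z∉extended ∘ there) circuit-unique) (length-circuit z) {suc l}
          (coordinate l) (δ (suc l)) (δ-≢ {suc l} {l} 1+n≢n) (δ-≡ (suc l))
          (zl ∷ All.map (λ s → s ≤-refl) circuit-supported)
          (bad ∘ good-pull {g = 𝟙} ε-closed
            (there (here ≈ᴹ-refl) ∷ here ≈ᴹ-refl ∷ All.map (there ∘ there) maps-id))))

        -- The transvection exchanging δ i with ones l adds δ i + ones l to z when the
        -- i-th coordinate of z is 1, and that vector is nonzero because l ≥ 2.
        z-below : ∀ i → i < l → coord z i ≡ false
        z-below i i<l = ¬-not λ zi →
          let j , j<l , i≢j = another i i<l
          in true≢false (trans (sym (cong₂ _xor_ (δ-≢ i≢j) (ones-< j<l)))
               (+-fixed⇒0 z (δ i +ᵛ ones l) (≈ᴹ-trans (≈ᴹ-sym (exchange-moves {z} zi))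
                 (bad-fixed hom extended-unique (length-circuit (δ l)) {π = exchange} exchange-GL
                   (here (exchange-fixes {δ l} (δ-≢ (≢-sym (<⇒≢ i<l)))) ∷
                    there (there (δ∈basis i<l exchange-v)) ∷ basis-All exchange-δ)
                   bad)) j))
          where
          open Exchange (coordinate i) (δ i) (ones l) (δ-≡ i) (ones-< i<l)
          exchange-δ : k < l → to exchange (δ k) ∈ extended
          exchange-δ {k} k<l with k ≟ i
          ... | yes refl = there (here exchange-u)
          ... | no  k≢i  = there (there (δ∈basis k<l (exchange-fixes {δ k} (δ-≢ k≢i))))

        -- The coordinates found above force `z` to be `δ l`, which is already a member of
        -- `extended`.
        impossible : ⊥
        impossible = z∉extended (here (supported-≈ z-supported (δ-supported ≤-refl) agree))
          where
          agree : i < suc l → coord z i ≡ coord (δ l) i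
          agree {i} i<1+l with i ≟ l
          ... | yes refl = trans z-l (sym (δ-≡ l))
          ... | no  i≢l  =
            trans (z-below i (≤∧≢⇒< (≤-pred i<1+l) i≢l)) (sym (δ-≢ (≢-sym i≢l)))

    no-bad : ¬ Bad (y ∷ basis (2 + l))
    no-bad bad = impossible (proj₂ (bad-exists hom extended-unique (length-circuit (δ l)) bad))

  -- The only candidate `ones 1` equals `δ 0`, a member of the basis.
  no-bad₁ : HomogeneousAt 1 → ¬ Bad (y ∷ basis 1)
  no-bad₁ hom bad = bad∉basis bad (here (≈ᴹ-trans (bad⇒ones hom bad)
    (pointwise λ { zero → refl ; (suc _) → refl })))

  -- From good lists to higher transitivity.

  -- π has to permute the standard basis for the induction to go through.
  arrange : ∀ f → Unique xs → All (λ x → Basic (to f x)) xs →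
            ∃[ π ] G π × (∀ k → Basic (to π (δ k))) × Sends (π ⊙ f) xs (basis (length xs))
  arrange f [] [] = 𝟙 , ε-closed , (λ k → k , ≈ᴹ-refl) , []
  arrange {x ∷ xs} f (x∉xs ∷ xs!) ((k , fx≈δk) ∷ basics) =
    let π , π∈G , π-basic , sends = arrange f xs! basics
    in extend π π∈G π-basic sends (π-basic k)
    where
    extend : ∀ π → G π → (∀ k → Basic (to π (δ k))) → Sends (π ⊙ f) xs (basis (length xs)) →
             Basic (to π (δ k)) → _
    extend π π∈G π-basic sends (j , πδk≈δj) with j ≟ length xs
    ... | yes refl = π , π∈G , π-basic , ≈ᴹ-trans (to-cong π fx≈δk) πδk≈δj ∷ sends
    ... | no  j≢n  = swap ⊙ π , ∙-closed {swap} {π} (GL⊆G swap-GL) π∈G ,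
      (λ k → let l , p = π-basic k
                 m , _ , q = swap-δ {k = l} {P = λ _ → ⊤} tt tt tt
             in m , ≈ᴹ-trans (to-cong swap p) q) ,
      ≈ᴹ-trans (to-cong swap πfx≈δj) swap-i ∷ fix ≤-refl sends
      where
      open Swap j≢n
      πfx≈δj : to π (to f x) ≈ᵛ δ j
      πfx≈δj = ≈ᴹ-trans (to-cong π fx≈δk) πδk≈δj
      n≤j : length xs ≤ j
      -- Each `δ j` with `j < length xs` is already the image of a member of `xs`, and `x` is not
      -- one.
      n≤j = ≮⇒≥ λ j<n → All¬⇒¬Any x∉xs
        (∈-resp-≈ Points (to-injective (π ⊙ f) (≈ᴹ-trans (strictlyInverseˡ (π ⊙ f) (δ j)) (≈ᴹ-sym πfx≈δj)))
          (All.lookupₛ Points (λ p → ∈-resp-≈ Points (from-cong (π ⊙ f) p))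
            (sends⇒maps⁻¹ {π = π ⊙ f} sends) (δ∈basis j<n ≈ᴹ-refl)))
      -- The list and `m` vary for the recursion; the swapped indices `j` and `length xs` are both
      -- at least `m`, so `basis m` stays fixed.
      fix : ∀ {zs m} → m ≤ length xs → Sends (π ⊙ f) zs (basis m) → Sends (swap ⊙ (π ⊙ f)) zs (basis m)
      fix {m = zero}  _   []       = []
      fix {m = suc m} m<n (p ∷ ps) =
        ≈ᴹ-trans (to-cong swap p) (swap-other (<⇒≢ (≤-trans m<n n≤j)) (<⇒≢ m<n)) ∷ fix (<⇒≤ m<n) ps

  -- Once the tail is moved onto `basis n`, the whole list is good; `arrange` then puts its images
  -- in order.
  homogeneous-suc : HomogeneousAt n → (∀ {y} → ¬ Bad (y ∷ basis n)) → HomogeneousAt (suc n)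
  homogeneous-suc {n} hom none {x ∷ xs} (x∉xs ∷ xs!) refl =
    let g , g∈G , sends = hom xs! refl
        f , f∈G , basics = good-pull {g = g} g∈G (here ≈ᴹ-refl ∷ All.map there (sends⇒maps {π = g} sends))
                             (decidable-stable em none)
        π , π∈G , _ , sends′ = arrange f (x∉xs ∷ xs!) basics
    in π ⊙ f , ∙-closed {π} {f} π∈G f∈G , sends′

  module _ (moves : ¬ Fixes Points G 0ᵛ) where

    -- A bad point can only be 0, and `G` maps bad points to bad points, so `G` would fix 0.
    no-bad₀ : ¬ Bad (y ∷ [])
    no-bad₀ {y} bad = moves λ {g} g∈G →
      ≈ᴹ-trans (to-cong g (≈ᴹ-sym (zero-of bad))) (zero-of (bad-push {g = g} g∈G [] bad))
      where
      zero-of : Bad (x ∷ []) → x ≈ᵛ 0ᵛ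
      zero-of bad = pointwise λ i → bad-supported bad z≤n

    no-bad-≢3 : ∀ n → n ≢ 3 → HomogeneousAt n → ¬ Bad (y ∷ basis n)
    no-bad-≢3 0             n≢3 hom = no-bad₀
    no-bad-≢3 1             n≢3 hom = no-bad₁ hom
    no-bad-≢3 (suc (suc l)) n≢3 hom = no-bad l (n≢3 ∘ cong (2 +_)) hom

    homogeneous₀ : HomogeneousAt 0
    homogeneous₀ {[]} [] refl = 𝟙 , ε-closed , []

    homogeneous₃ : HomogeneousAt 3
    homogeneous₃ = homogeneous-suc hom₂ (no-bad-≢3 2 (λ ()) hom₂)
      where
      hom₁ = homogeneous-suc homogeneous₀ (no-bad-≢3 0 (λ ()) homogeneous₀)
      hom₂ = homogeneous-suc hom₁ (no-bad-≢3 1 (λ ()) hom₁)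

    homogeneous : (∀ {y} → ¬ Bad (y ∷ basis 3)) → ∀ n → HomogeneousAt n
    homogeneous none₃ zero    = homogeneous₀
    homogeneous none₃ (suc n) = homogeneous-suc (homogeneous none₃ n) (none n (homogeneous none₃ n))
      where
      none : ∀ n → HomogeneousAt n → ¬ Bad (y ∷ basis n)
      none n hom with n ≟ 3
      ... | yes refl = none₃
      ... | no  n≢3  = no-bad-≢3 n n≢3 hom

  -- High transitivity and closedness give the full symmetric group.

  _≈?_ : Decidable _≈ᵛ_
  x ≈? y = map′ lower (lift {ℓ = ℓ}) em

  -- On a finite set, `g` takes the points and `h` their images under π to the same basis list, so
  -- `h ⁻` after `g` agrees with π there.
  homogeneous⇒Sym : Closed Points G → (∀ n → HomogeneousAt n) → ∀ π → G π
  homogeneous⇒Sym closed hom π = closed π λ S →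
    let S! = deduplicate-! ≈-decSetoid S
        g , g∈G , g-sends = hom (length (deduplicate _≈?_ S)) S! refl
        h , h∈G , h-sends = hom (length (deduplicate _≈?_ S)) (map⁺ Points Points (to-injective π) S!)
                                (length-map (to π) (deduplicate _≈?_ S))
        σ = (h ⁻) ⊙ g
    in σ , ∙-closed {h ⁻} {g} (⁻¹-closed h∈G) g∈G ,
       All.tabulateₛ Points λ x∈S → All.lookupₛ Points
         (λ p q → ≈ᴹ-trans (to-cong σ (≈ᴹ-sym p)) (≈ᴹ-trans q (to-cong π p)))
         (agree g h g-sends h-sends)
         (∈-deduplicate⁺ Points _≈?_ (λ p q → ≈ᴹ-trans q (≈ᴹ-sym p)) x∈S)
    where
    ≈-decSetoid : DecSetoid 0ℓ 0ℓ
    ≈-decSetoid = record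
      { isDecEquivalence = record { isEquivalence = Setoid.isEquivalence Points ; _≟_ = _≈?_ } }
    agree : ∀ g h → Sends g xs ys → Sends h (map (to π) xs) ys →
            All (λ x → from h (to g x) ≈ᵛ to π x) xs
    agree {[]}     g h []       []       = []
    agree {x ∷ xs} g h (p ∷ ps) (q ∷ qs) =
      ≈ᴹ-trans (from-cong h (≈ᴹ-trans p (≈ᴹ-sym q))) (strictlyInverseʳ h (to π x)) ∷ agree g h ps qs

  supported? : ∀ n x → Supported n x ⊎ (∃[ k ] n ≤ k × coord x k ≡ true)
  supported? n x with map′ lower (lift {ℓ = ℓ}) em
  ... | yes outside = inj₂ outside
  ... | no  inside  = inj₁ λ {i} n≤i → ¬-not λ xi → inside (i , n≤i , xi)

  -- For `n = 3`, the bad extension of a triple is its sum.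

  module _ (hom : HomogeneousAt 3) where

    reflect-sum : ∀ {π} → GL π → to π z ≈ᵛ (to π x +ᵛ to π y) +ᵛ to π w → z ≈ᵛ (x +ᵛ y) +ᵛ w
    reflect-sum {x = x} {y = y} {w = w} {π = π} π∈GL p = to-injective π
      (≈ᴹ-trans p (≈ᴹ-sym (≈ᴹ-trans (GL⇒additive {π} π∈GL (x +ᵛ y) w)
        (pointwise λ i → cong (_xor coord (to π w) i) (at (GL⇒additive {π} π∈GL x y) i)))))

    -- The span of `δ 0` and `δ 1` has four points, with sum 0, and `z` is the one not listed.
    bad-sum-plane : Unique (δ 0 ∷ δ 1 ∷ w ∷ []) → Supported 2 w → Supported 2 z →
                    z ∉ (δ 0 ∷ δ 1 ∷ w ∷ []) → z ≈ᵛ (δ 0 +ᵛ δ 1) +ᵛ w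
    bad-sum-plane {w} {z} ((_ ∷ δ₀≉w ∷ []) ∷ (δ₁≉w ∷ []) ∷ _) w-supp z-supp z∉ =
      go _ _ _ _ refl refl refl refl
      where
      agree : Supported 2 x → Supported 2 y → coord x 0 ≡ coord y 0 → coord x 1 ≡ coord y 1 → x ≈ᵛ y
      agree sx sy p q = supported-≈ sx sy
        λ { {0} _ → p ; {1} _ → q ; {suc (suc _)} (s≤s (s≤s ())) }
      sum-supp : Supported 2 ((δ 0 +ᵛ δ 1) +ᵛ w)
      sum-supp 2≤i = cong₂ _xor_ (cong₂ _xor_ (δ-supported z<s 2≤i) (δ-supported (s≤s z<s) 2≤i)) (w-supp 2≤i)
      go : ∀ a b c d → coord w 0 ≡ a → coord w 1 ≡ b → coord z 0 ≡ c → coord z 1 ≡ d →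
           z ≈ᵛ (δ 0 +ᵛ δ 1) +ᵛ w
      go true  false _     _     w₀ w₁ z₀ z₁ =
        contradiction (agree (δ-supported z<s) w-supp (sym w₀) (sym w₁)) δ₀≉w
      go false true  _     _     w₀ w₁ z₀ z₁ =
        contradiction (agree (δ-supported (s≤s z<s)) w-supp (sym w₀) (sym w₁)) δ₁≉w
      go _     _     true  false w₀ w₁ z₀ z₁ =
        contradiction (here (agree z-supp (δ-supported z<s) z₀ z₁)) z∉
      go _     _     false true  w₀ w₁ z₀ z₁ =
        contradiction (there (here (agree z-supp (δ-supported (s≤s z<s)) z₀ z₁))) z∉
      go true  true  true  true  w₀ w₁ z₀ z₁ =
        contradiction (there (there (here (agree z-supp w-supp (trans z₀ (sym w₀)) (trans z₁ (sym w₁)))))) z∉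
      go false false false false w₀ w₁ z₀ z₁ =
        contradiction (there (there (here (agree z-supp w-supp (trans z₀ (sym w₀)) (trans z₁ (sym w₁)))))) z∉
      -- Both coordinates of `δ 0 +ᵛ δ 1` are 1, so adding `w` negates its coordinates.
      go true  true  false false w₀ w₁ z₀ z₁ =
        agree z-supp sum-supp (trans z₀ (cong not (sym w₀))) (trans z₁ (cong not (sym w₁)))
      go false false true  true  w₀ w₁ z₀ z₁ =
        agree z-supp sum-supp (trans z₀ (cong not (sym w₀))) (trans z₁ (cong not (sym w₁)))

    -- If `w` is outside the plane of `δ 0` and `δ 1`, it can be pivoted to `δ 2`, where the bad
    -- point is `ones 3`; otherwise `z` lies in that plane as well.
    bad-sum-δ : Unique (δ 0 ∷ δ 1 ∷ w ∷ []) → Bad (z ∷ δ 0 ∷ δ 1 ∷ w ∷ []) → z ≈ᵛ (δ 0 +ᵛ δ 1) +ᵛ w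
    bad-sum-δ {w} {z} xs! bad with supported? 2 w
    ... | inj₂ (k , 2≤k , wk) =
      let π , π∈GL , πw , _ , fixes = pivot 2 w 2≤k wk
          πδ₀ = fixes (δ-supported z<s)
          πδ₁ = fixes (δ-supported (s≤s z<s))
          πz = bad⇒ones hom (bad-push {g = π} (GL⊆G π∈GL)
            (there (there (here πδ₀)) ∷ there (here πδ₁) ∷ here πw ∷ []) bad)
      in reflect-sum {π = π} π∈GL (≈ᴹ-trans πz (pointwise λ i →
           trans (ones₃ i) (sym (cong₂ _xor_ (cong₂ _xor_ (at πδ₀ i) (at πδ₁ i)) (at πw i)))))
      where
      ones₃ : ∀ i → coord (ones 3) i ≡ (coord (δ 0) i xor coord (δ 1) i) xor coord (δ 2) i
      ones₃ 0 = refl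
      ones₃ 1 = refl
      ones₃ 2 = refl
      ones₃ (suc (suc (suc _))) = refl
    ... | inj₁ w-supp = bad-sum-plane xs! w-supp z-supp (bad-∉ hom xs! refl bad)
      where
      z-supp : Supported 2 z
      z-supp {k} 2≤k = bad-vanishing hom xs! refl {0} (coordinate k) (δ 0) (δ-supported z<s 2≤k) (δ-≡ 0)
        (δ-supported z<s 2≤k ∷ δ-supported (s≤s z<s) 2≤k ∷ w-supp 2≤k ∷ []) bad

    -- Distinct nonzero vectors over 𝔽₂ are linearly independent, so two pivots bring `x` and `y` to
    -- `δ 0` and `δ 1`.
    bad-sum-nonzero : ¬ x ≈ᵛ 0ᵛ → ¬ y ≈ᵛ 0ᵛ → Unique (x ∷ y ∷ w ∷ []) → Bad (z ∷ x ∷ y ∷ w ∷ []) →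
                      z ≈ᵛ (x +ᵛ y) +ᵛ w
    bad-sum-nonzero {x} {y} {w} {z} x≉0 y≉0 ((x≉y ∷ x≉w ∷ []) ∷ (y≉w ∷ []) ∷ _) bad =
      [ (λ s → contradiction (pointwise λ i → s z≤n) x≉0)
      , (λ (k , 0≤k , xk) → first (pivot 0 x 0≤k xk)) ] (supported? 0 x)
      where
      first : (∃[ π ] GL π × to π x ≈ᵛ δ 0 × to π (δ 0) ≈ᵛ x × (∀ {u} → Supported 0 u → to π u ≈ᵛ u)) → _
      first (π , π∈GL , πx , πδ₀ , fixes) =
        [ (λ s → contradiction s outside) , (λ (k , 1≤k , πyk) → second (pivot 1 (to π y) 1≤k πyk)) ]
          (supported? 1 (to π y))
        where
        π0 : to π 0ᵛ ≈ᵛ 0ᵛ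
        π0 = fixes λ _ → refl
        outside : ¬ Supported 1 (to π y)
        outside s with coord (to π y) 0 in πy₀
        ... | true = x≉y (to-injective π (≈ᴹ-trans πx (supported-≈ (δ-supported z<s) s
                        λ { {0} _ → sym πy₀ ; {suc _} (s≤s ()) })))
        ... | false = y≉0 (to-injective π (≈ᴹ-trans (supported-≈ s (λ _ → refl)
                        λ { {0} _ → πy₀ ; {suc _} (s≤s ()) }) (≈ᴹ-sym π0)))
        second : (∃[ ρ ] GL ρ × to ρ (to π y) ≈ᵛ δ 1 × to ρ (δ 1) ≈ᵛ to π y ×
                  (∀ {u} → Supported 1 u → to ρ u ≈ᵛ u)) → z ≈ᵛ (x +ᵛ y) +ᵛ w
        second (ρ , ρ∈GL , ρy , _ , fixes) = reflect-sum {π = π} π∈GL (reflect-sum {π = ρ} ρ∈GL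
          (≈ᴹ-trans sum (pointwise λ i → sym (cong (_xor coord (to σ w) i) (cong₂ _xor_ (at σx i) (at ρy i))))))
          where
          σ : Permutation
          σ = ρ ⊙ π
          σx : to σ x ≈ᵛ δ 0
          σx = ≈ᴹ-trans (to-cong ρ πx) (fixes (δ-supported z<s))
          sum : to σ z ≈ᵛ (δ 0 +ᵛ δ 1) +ᵛ to σ w
          sum = bad-sum-δ
            (((λ p → x≉y (to-injective σ (≈ᴹ-trans σx (≈ᴹ-trans p (≈ᴹ-sym ρy))))) ∷
              (λ p → x≉w (to-injective σ (≈ᴹ-trans σx p))) ∷ []) ∷
             ((λ p → y≉w (to-injective σ (≈ᴹ-trans ρy p))) ∷ []) ∷ [] ∷ [])
            (bad-push {g = σ} (∙-closed {ρ} {π} (GL⊆G ρ∈GL) (GL⊆G π∈GL))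
              (here σx ∷ there (here ρy) ∷ there (there (here ≈ᴹ-refl)) ∷ []) bad)

    -- At most one of three distinct points is 0; reordering puts it third, where `bad-sum-nonzero`
    -- allows it.
    bad-sum : Unique (x ∷ y ∷ w ∷ []) → Bad (z ∷ x ∷ y ∷ w ∷ []) → z ≈ᵛ (x +ᵛ y) +ᵛ w
    bad-sum {x} {y} {w} {z} xs!@((x≉y ∷ x≉w ∷ []) ∷ (y≉w ∷ []) ∷ _) bad with x ≈? 0ᵛ | y ≈? 0ᵛ
    ... | no  x≉0 | no  y≉0 = bad-sum-nonzero x≉0 y≉0 xs! bad
    ... | yes x≈0 | _ = ≈ᴹ-trans
      (bad-sum-nonzero (λ w≈0 → x≉w (≈ᴹ-trans x≈0 (≈ᴹ-sym w≈0))) (λ y≈0 → x≉y (≈ᴹ-trans x≈0 (≈ᴹ-sym y≈0)))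
        (((y≉w ∘ ≈ᴹ-sym) ∷ (x≉w ∘ ≈ᴹ-sym) ∷ []) ∷ ((x≉y ∘ ≈ᴹ-sym) ∷ []) ∷ [] ∷ [])
        (bad ∘ good-pull {g = 𝟙} ε-closed
          (here ≈ᴹ-refl ∷ there (there (there (here ≈ᴹ-refl))) ∷ there (there (here ≈ᴹ-refl)) ∷
           there (here ≈ᴹ-refl) ∷ [])))
      (pointwise λ i → rearrange (coord w i) (coord y i) (coord x i))
      where
      rearrange : ∀ a b c → (a xor b) xor c ≡ (c xor b) xor a
      rearrange a b c = trans (xor-comm (a xor b) c)
        (trans (cong (c xor_) (xor-comm a b)) (sym (xor-assoc c b a)))
    ... | no  x≉0 | yes y≈0 = ≈ᴹ-trans
      (bad-sum-nonzero x≉0 (λ w≈0 → y≉w (≈ᴹ-trans y≈0 (≈ᴹ-sym w≈0)))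
        ((x≉w ∷ x≉y ∷ []) ∷ ((y≉w ∘ ≈ᴹ-sym) ∷ []) ∷ [] ∷ [])
        (bad ∘ good-pull {g = 𝟙} ε-closed
          (here ≈ᴹ-refl ∷ there (here ≈ᴹ-refl) ∷ there (there (there (here ≈ᴹ-refl))) ∷
           there (there (here ≈ᴹ-refl)) ∷ [])))
      (pointwise λ i → rearrange (coord x i) (coord w i) (coord y i))
      where
      rearrange : ∀ a b c → (a xor b) xor c ≡ (a xor c) xor b
      rearrange a b c = trans (xor-assoc a b c)
        (trans (cong (a xor_) (xor-comm b c)) (sym (xor-assoc a c b)))

    -- A bad extension at 3 makes `G` the affine group.

    module _ (bad₃ : Bad (z ∷ basis 3)) where

      -- Every triple of distinct points has a bad extension, its sum, and `g` carries bad
      -- extensions to bad extensions.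
      preserves-sum : ∀ {g} → G g → Unique (x ∷ y ∷ w ∷ []) →
                      to g ((x +ᵛ y) +ᵛ w) ≈ᵛ (to g x +ᵛ to g y) +ᵛ to g w
      preserves-sum {g = g} g∈G xs! =
        let z , bad = bad-exists hom xs! refl bad₃
        in ≈ᴹ-trans (to-cong g (≈ᴹ-sym (bad-sum xs! bad)))
             (bad-sum (map⁺ Points Points (to-injective g) xs!)
               (bad-push {g = g} g∈G
                 (here ≈ᴹ-refl ∷ there (here ≈ᴹ-refl) ∷ there (there (here ≈ᴹ-refl)) ∷ []) bad))

      -- This is `preserves-sum` for the triple `x`, `y`, 0; when two of these coincide, terms
      -- cancel.
      affine : ∀ {g} → G g → ∀ x y → to g (x +ᵛ y) ≈ᵛ (to g x +ᵛ to g y) +ᵛ to g 0ᵛ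
      affine {g} g∈G x y with x ≈? 0ᵛ | y ≈? 0ᵛ | x ≈? y
      ... | yes x≈0 | _ | _ = ≈ᴹ-trans
        (to-cong g (pointwise λ i → cong (_xor coord y i) (at x≈0 i)))
        (pointwise λ i → trans (sym (trans (cong (_xor coord (to g 0ᵛ) i) 
            (xor-comm (coord (to g 0ᵛ) i) (coord (to g y) i))) (xor-cancelʳ (coord (to g y) i) (coord (to g 0ᵛ) i))))
          (cong (λ a → (a xor coord (to g y) i) xor coord (to g 0ᵛ) i) (sym (at (to-cong g x≈0) i))))
      ... | no _ | yes y≈0 | _ = ≈ᴹ-trans
        (to-cong g (pointwise λ i → trans (cong (coord x i xor_) (at y≈0 i)) (xor-identityʳ _)))
        (pointwise λ i → trans (sym (xor-cancelʳ (coord (to g x) i) (coord (to g 0ᵛ) i)))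
          (cong (λ a → (coord (to g x) i xor a) xor coord (to g 0ᵛ) i) (sym (at (to-cong g y≈0) i))))
      ... | no _ | no _ | yes x≈y = ≈ᴹ-trans
        (to-cong g (pointwise λ i → trans (cong (_xor coord y i) (at x≈y i)) (xor-same (coord y i))))
        (pointwise λ i → cong (_xor coord (to g 0ᵛ) i) (sym
          (trans (cong (_xor coord (to g y) i) (at (to-cong g x≈y) i)) (xor-same (coord (to g y) i)))))
      ... | no x≉0 | no y≉0 | no x≉y = ≈ᴹ-trans
        (to-cong g (pointwise λ i → sym (xor-identityʳ _)))
        (preserves-sum {g = g} g∈G ((x≉y ∷ x≉0 ∷ []) ∷ (y≉0 ∷ []) ∷ [] ∷ []))

      linearPart : Permutation → Permutation
      linearPart g = translation (to g 0ᵛ) ⊙ g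

      linearPart-GL : ∀ {g} → G g → GL (linearPart g)
      linearPart-GL {g} g∈G = additive⇒GL {linearPart g} λ x y → pointwise λ i →
        trans (cong (_xor coord (to g 0ᵛ) i) (at (affine {g} g∈G x y) i))
        (trans (xor-assoc (coord (to g x) i xor coord (to g y) i) (coord (to g 0ᵛ) i) (coord (to g 0ᵛ) i))
               (interchange (coord (to g x) i) (coord (to g y) i) (coord (to g 0ᵛ) i) (coord (to g 0ᵛ) i)))

      ⊆AGL : G ⊆ AGL
      ⊆AGL {g} g∈G = resp
        (λ x → pointwise λ i → xor-cancelʳ (coord (to g x) i) (coord (to g 0ᵛ) i))
        (_∙_ {x = translation (to g 0ᵛ)} {y = linearPart g}
          (gen (inj₂ (to g 0ᵛ , λ x → ≈ᴹ-refl))) (gen (inj₁ (linearPart-GL {g} g∈G))))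

      -- Some `g` moves 0 to a nonzero `a`; removing its linear part leaves the translation by `a`,
      -- and a linear conjugation turns `a` into `b`.
      translation∈ : ¬ Fixes Points G 0ᵛ → ∀ b → G (translation b)
      translation∈ moves b with b ≈? 0ᵛ
      ... | yes b≈0 = G-resp (λ x → pointwise λ i → sym
              (trans (cong (coord x i xor_) (at b≈0 i)) (xor-identityʳ _))) ε-closed
      ... | no b≉0 with em {P = ∃[ g ] G g × ¬ to g 0ᵛ ≈ᵛ 0ᵛ}
      ...   | no none = contradiction
        (λ {g} g∈G → decidable-stable (to g 0ᵛ ≈? 0ᵛ) λ p → none (g , g∈G , p)) moves
      ...   | yes (g , g∈G , a≉0) with supported? 0 (to g 0ᵛ) | supported? 0 b
      ...     | inj₁ s | _ = contradiction (pointwise λ i → s z≤n) a≉0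
      ...     | _ | inj₁ s = contradiction (pointwise λ i → s z≤n) b≉0
      ...     | inj₂ (k , 0≤k , ak) | inj₂ (l , 0≤l , bl)
        -- The linear map from `a` to `b` passes through `δ 0`.
        with pivot 0 (to g 0ᵛ) 0≤k ak | pivot 0 b 0≤l bl
      ...       | π , π∈GL , πa , _ | ρ , ρ∈GL , _ , ρδ , _ =
        G-resp {x = (σ ⊙ t) ⊙ (σ ⁻)} {y = translation b} conjugate
          (∙-closed {σ ⊙ t} {σ ⁻} (∙-closed {σ} {t} σ∈G t∈G) (⁻¹-closed {σ} σ∈G))
        where
        a : Vector
        a = to g 0ᵛ
        σ t : Permutation
        σ = ρ ⊙ π
        t = translation a
        σ∈G : G σ
        σ∈G = ∙-closed {ρ} {π} (GL⊆G ρ∈GL) (GL⊆G π∈GL)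
        σa≈b : to σ a ≈ᵛ b
        σa≈b = ≈ᴹ-trans (to-cong ρ πa) ρδ
        σ-additive : Additive σ
        σ-additive x y = ≈ᴹ-trans (to-cong ρ (GL⇒additive {π} π∈GL x y)) (GL⇒additive {ρ} ρ∈GL _ _)
        t∈G : G t
        t∈G = G-resp {x = g ⊙ (linearPart g ⁻)} {y = t} (λ x → strictlyInverseˡ g (x +ᵛ a))
          (∙-closed {g} {linearPart g ⁻} g∈G (⁻¹-closed {linearPart g} (GL⊆G (linearPart-GL {g} g∈G))))
        conjugate : ∀ x → to σ (from σ x +ᵛ a) ≈ᵛ x +ᵛ b
        conjugate x = ≈ᴹ-trans (σ-additive (from σ x) a)
          (pointwise λ i → cong₂ _xor_ (at (strictlyInverseˡ σ x) i) (at σa≈b i))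

      AGL⊆ : ¬ Fixes Points G 0ᵛ → AGL ⊆ G
      AGL⊆ moves = generated
        where
        generated : AGL ⊆ G
        generated (gen (inj₁ π∈GL)) = GL⊆G π∈GL
        generated (gen {π} (inj₂ (a , p))) =
          G-resp {x = translation a} {y = π} (λ x → ≈ᴹ-sym (p x)) (translation∈ moves a)
        generated (resp {π} {ρ} p h) = G-resp {x = π} {y = ρ} p (generated h)
        generated ε = ε-closed
        generated (_∙_ {π} {ρ} h k) = ∙-closed {π} {ρ} (generated h) (generated k)
        generated (_⁻¹ {π} h) = ⁻¹-closed {π} (generated h)

  -- The dichotomy: whether `basis 3` has a bad extension.

  classification : Closed Points G → ¬ Fixes Points G 0ᵛ → (G ≐ AGL) ⊎ (G ≐ U)
  classification closed moves = decide em
    where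
    decide : Dec (∃[ y ] Bad (y ∷ basis 3)) → (G ≐ AGL) ⊎ (G ≐ U)
    decide (yes (y , bad)) =
      inj₁ ((λ {π} → ⊆AGL (homogeneous₃ moves) bad {π}) , λ {π} → AGL⊆ (homogeneous₃ moves) bad moves {π})
    decide (no none) = inj₂ ((λ _ → _) , λ {π} _ →
      homogeneous⇒Sym closed (homogeneous moves λ {y} bad → none (y , bad)) π)

theorem2p5 : ∀ {ℓ} → ExcludedMiddle ℓ →
    (G : Pred Permutation ℓ) →
    IsSubgroup Sym[𝔽₂^ω] G →
    Closed Points G →
    GL ⊂ G →
    ¬ Fixes Points G 0ᵛ →
    (G ≐ AGL) ⊎ (G ≐ U)
theorem2p5 em G G-subgroup closed (GL⊆G , _) moves =
  classification em G G-subgroup (λ {π} → GL⊆G {π}) closed moves
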